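{- There are continuum-many equational theories of classes of idempotent semifields; that is, the set $\{\mathrm{Eq}(\mathsf{K}) \mid \mathsf{K} \text{ is a class of idempotent semifields}\}$ has cardinality $2^{\aleph_0}$.
   Context: An idempotent semiring is an algebraic structure $\langle S,\vee,\cdot,\mathrm{e}\rangle$ such that $\langle S,\cdot,\mathrm{e}\rangle$ is a monoid, $\langle S,\vee\rangle$ is a semilattice (an idempotent commutative semigroup), and $a(b\vee c)d=abd\vee acd$ for all $a,b,c,d\in S$. It is called an idempotent semifield if $\langle S,\cdot,\mathrm{e}\rangle$ is the monoid reduct of a group. The signature is $\{\vee,\cdot,\mathrm{e}\}$ (no inverse operation and no meet). Terms are built from a countably infinite set of variables; an equation $s\approx t$ is an ordered pair of terms, satisfied by an algebra $\mathbf{A}$ if $\varphi(s)=\varphi(t)$ for every homomorphism $\varphi$ from the term algebra to $\mathbf{A}$. $\mathrm{Eq}(\mathsf{K})$ denotes the set of all equations in the signature $\{\vee,\cdot,\mathrm{e}\}$ satisfied by every member of $\mathsf{K}$. -}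

module Defs where

open import Algebra.Bundles.Raw using (RawMagma; RawMonoid)
open import Algebra.Lattice.Structures using (IsSemilattice)
open import Algebra.Morphism.Structures using (IsMagmaHomomorphism; IsMonoidHomomorphism)
open import Algebra.Structures using (IsMonoid; IsGroup)
open import Data.Nat.Base using (ℕ)
open import Data.Product.Base using (Σ-syntax; ∃; _×_; _,_; proj₁)
open import Level using (Level; _⊔_; suc; 0ℓ)
open import Relation.Binary.Bundles using (Setoid)
open import Relation.Binary.Core using (Rel)
open import Relation.Binary.PropositionalEquality.Core using (_≡_)
import Relation.Binary.Construct.On as On
open import Relation.Unary using (Pred; _∈_; _≐_)
open import Relation.Unary.Relation.Binary.Equality using (≐-setoid)

record RawIdempotentSemiring (c ℓ : Level) : Set (suc (c ⊔ ℓ)) where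
  infix  4 _≈_
  infixl 6 _∨_
  infixl 7 _·_
  field
    Carrier : Set c
    _≈_     : Rel Carrier ℓ
    _∨_     : Carrier → Carrier → Carrier
    _·_     : Carrier → Carrier → Carrier
    e       : Carrier

  ∨-rawMagma : RawMagma c ℓ
  ∨-rawMagma = record { _≈_ = _≈_ ; _∙_ = _∨_ }

  ·-rawMonoid : RawMonoid c ℓ
  ·-rawMonoid = record { _≈_ = _≈_ ; _∙_ = _·_ ; ε = e }

-- Unlike the idempotent semirings of Algebra.Structures, these have no zero.
record IsIdempotentSemiring {c ℓ} (S : RawIdempotentSemiring c ℓ) : Set (c ⊔ ℓ) where
  open RawIdempotentSemiring S
  field
    ·-isMonoid      : IsMonoid _≈_ _·_ e
    ∨-isSemilattice : IsSemilattice _≈_ _∨_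
    distrib         : ∀ a b c d → a · (b ∨ c) · d ≈ a · b · d ∨ a · c · d

record IsIdempotentSemifield {c ℓ} (S : RawIdempotentSemiring c ℓ) : Set (c ⊔ ℓ) where
  open RawIdempotentSemiring S
  field
    isIdempotentSemiring : IsIdempotentSemiring S
    ·-isGroupReduct      : ∃ λ _⁻¹ → IsGroup _≈_ _·_ e _⁻¹

record IdempotentSemifield (c ℓ : Level) : Set (suc (c ⊔ ℓ)) where
  field
    raw                   : RawIdempotentSemiring c ℓ
    isIdempotentSemifield : IsIdempotentSemifield raw

record IsHomomorphism {c₁ ℓ₁ c₂ ℓ₂}
                      (A : RawIdempotentSemiring c₁ ℓ₁)
                      (B : RawIdempotentSemiring c₂ ℓ₂)
                      (φ : RawIdempotentSemiring.Carrier A → RawIdempotentSemiring.Carrier B)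
                      : Set (c₁ ⊔ ℓ₁ ⊔ ℓ₂) where
  private
    module A = RawIdempotentSemiring A
    module B = RawIdempotentSemiring B
  field
    ∨-isMagmaHomomorphism  : IsMagmaHomomorphism A.∨-rawMagma B.∨-rawMagma φ
    ·-isMonoidHomomorphism : IsMonoidHomomorphism A.·-rawMonoid B.·-rawMonoid φ

infixl 6 _∨_
infixl 7 _·_

data Term : Set where
  var     : ℕ → Term
  _∨_ _·_ : Term → Term → Term
  e       : Term

termAlgebra : RawIdempotentSemiring 0ℓ 0ℓ
termAlgebra = record
  { Carrier = Term
  ; _≈_     = _≡_
  ; _∨_     = _∨_
  ; _·_     = _·_
  ; e       = e
  }

Equation : Set
Equation = Term × Term

infix 4 _⊨_

_⊨_ : ∀ {c ℓ} → IdempotentSemifield c ℓ → Equation → Set (c ⊔ ℓ)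
A ⊨ (s , t) = ∀ (φ : Term → Carrier) → IsHomomorphism termAlgebra raw φ → φ s ≈ φ t
  where
  open IdempotentSemifield A using (raw)
  open RawIdempotentSemiring raw using (Carrier; _≈_)

Class : (c ℓ k : Level) → Set (suc (c ⊔ ℓ ⊔ k))
Class c ℓ k = Pred (IdempotentSemifield c ℓ) k

Eq : ∀ {c ℓ k} → Class c ℓ k → Pred Equation (suc (c ⊔ ℓ) ⊔ k)
Eq K ε = ∀ A → A ∈ K → A ⊨ ε

-- The set { Eq K | K a class of idempotent semifields }: its elements are sets
-- of equations, compared extensionally; the class K is not part of the equality.
EquationalTheories : (c ℓ k : Level) → Setoid (suc (suc (c ⊔ ℓ) ⊔ k)) (suc (c ⊔ ℓ) ⊔ k)
EquationalTheories c ℓ k =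
  On.setoid {B = Σ[ T ∈ Pred Equation (suc (c ⊔ ℓ) ⊔ k) ] Σ[ K ∈ Class c ℓ k ] T ≐ Eq K}
            (≐-setoid Equation (suc (c ⊔ ℓ) ⊔ k)) proj₁

{-# OPTIONS --safe #-}

-- Let q = 4n + 2 and let Aₙ be the group of affine maps x ↦ qᵏ x + b (k ∈ ℤ, b ∈ ℚ),
-- ordered lexicographically with the slope first. It is totally ordered, so it is an
-- idempotent semifield. In a totally ordered group a disjunction of inequalities is
-- a single equation. Call such a disjunction violated by an assignment when all its
-- members fail. With P = xy and Q = yx, which have equal slopes, the inequalities
-- PPQ ≤ QQP and QPP ≤ PQQ fail together only if P and Q have slope 1 and P > Q; given
-- this, Qᵐ x P ≤ Pᵐ x Q fails iff the slope of x exceeds m, and with P and Q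
-- exchanged iff it is below m. So one equation εₙ says that no such x has slope
-- strictly between q − 1 and q + 1. Since q is a proper power of no number of the form
-- 4m + 2, the equation εₙ fails in Aₙ and holds in every other Aₘ. Hence every
-- subset of { εₙ } is cut out by an equational theory, and Cantor–Bernstein applies
-- because the set of all equations is countable.

module Submission where

import Algebra.Construct.NaturalChoice.Max as Max
open import Algebra.Bundles using (CommutativeRing)
open import Algebra.Core using (Op₁; Op₂)
open import Algebra.Morphism.Structures using (IsMagmaHomomorphism; IsMonoidHomomorphism)
import Algebra.Properties.Semiring.Exp as Exp
import Algebra.Properties.Semiring.Mult as Mult
open import Algebra.Structures using (IsGroup)
open import Axiom.ExcludedMiddle using (ExcludedMiddle)
open import Data.Bool.Base using (Bool; true; T)
open import Data.Bool.Properties using (T?; T-≡; ⇔→≡)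
open import Data.Integer.Base as ℤ using (ℤ; +_; -[1+_]; _⊖_; 0ℤ; 1ℤ; -1ℤ)
import Data.Integer.Properties as ℤ
open import Data.Nat.Base as ℕ using (ℕ; zero; suc; z≤n; s≤s)
import Data.Nat.Properties as ℕ
open import Data.Nat.Tactic.RingSolver using (solve-∀)
open import Data.Product.Base using (∃; _×_; _,_; proj₁; proj₂)
open import Data.Product.Relation.Binary.Lex.Strict using (×-Lex; ×-transitive; ×-compare)
open import Data.Rational.Solver using (module +-*-Solver)
open import Data.Sum.Base as Sum using (inj₁; inj₂)
open import Function.Base using (_∘_)
open import Function.Bundles using (Bijection; Injection; _⇔_; mk⇔; module Equivalence)
open import Level using (Level; Lift; lift; lower; 0ℓ)
open import Relation.Binary.Bundles using (Setoid; TotalOrder)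
import Relation.Binary.Construct.StrictToNonStrict as StrictToNonStrict
open import Relation.Binary.Core using (Rel)
open import Relation.Binary.Definitions using (tri<; tri≈; tri>; Trichotomous)
open import Relation.Binary.PropositionalEquality
open import Relation.Binary.Structures using (IsStrictTotalOrder)
open import Relation.Nullary
open import Relation.Nullary.Decidable
  using (True; toWitness; fromWitness; ⌊_⌋; decidable-stable)
open import Relation.Unary using (Pred; _∈_)
open import Defs
open Equivalence using (to; from)

-- The Cantor-Bernstein theorem for setoids

module CantorBernstein
  (em : ∀ a → ExcludedMiddle a)
  {a b ℓ₁ ℓ₂} {A : Setoid a ℓ₁} {B : Setoid b ℓ₂}
  (f : Injection A B) (g : Injection B A)
  where

  private
    module A = Setoid A
    module B = Setoid B
    module F = Injection f
    module G = Injection g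

  InImage : A.Carrier → Set _
  InImage x = ∃ λ y → G.to y A.≈ x

  -- The points whose backward orbit under f and g stops outside the image of g.
  data Stopper : A.Carrier → Set (a Level.⊔ b Level.⊔ ℓ₁) where
    start : ∀ {x} → ¬ InImage x → Stopper x
    step  : ∀ {x y} → Stopper x → G.to (F.to x) A.≈ y → Stopper y

  Stopper-resp : ∀ {x y} → x A.≈ y → Stopper x → Stopper y
  Stopper-resp x≈y (start x∉) = start λ (z , gz≈y) → x∉ (z , A.trans gz≈y (A.sym x≈y))
  Stopper-resp x≈y (step s p) = step s (A.trans p x≈y)

  ¬Stopper⇒InImage : ∀ {x} → ¬ Stopper x → InImage x
  ¬Stopper⇒InImage ¬s = decidable-stable (em _) (¬s ∘ start)

  -- The decision is an argument, so that the properties below can be proved by cases for arbitrary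
  -- decisions; `em` is supplied only at the end.
  match : ∀ x → Dec (Stopper x) → B.Carrier
  match x (yes _) = F.to x
  match x (no ¬s) = proj₁ (¬Stopper⇒InImage ¬s)

  match-cong : ∀ {x y} (d : Dec (Stopper x)) (d′ : Dec (Stopper y)) →
               x A.≈ y → match x d B.≈ match y d′
  match-cong (yes _) (yes _)  x≈y = F.cong x≈y
  match-cong (yes s) (no ¬s)  x≈y = contradiction (Stopper-resp x≈y s) ¬s
  match-cong (no ¬s) (yes s)  x≈y = contradiction (Stopper-resp (A.sym x≈y) s) ¬s
  match-cong (no ¬s) (no ¬s′) x≈y =
    let (_ , p) = ¬Stopper⇒InImage ¬s ; (_ , p′) = ¬Stopper⇒InImage ¬s′
    in G.injective (A.trans p (A.trans x≈y (A.sym p′)))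

  -- In a mixed case one point would be the image under f and then g of the other, which is a
  -- stopper, and would therefore be a stopper itself.
  match-injective : ∀ {x y} (d : Dec (Stopper x)) (d′ : Dec (Stopper y)) →
                    match x d B.≈ match y d′ → x A.≈ y
  match-injective (yes _) (yes _)  eq = F.injective eq
  match-injective (yes s) (no ¬s)  eq =
    contradiction (step s (A.trans (G.cong eq) (proj₂ (¬Stopper⇒InImage ¬s)))) ¬s
  match-injective (no ¬s) (yes s)  eq =
    contradiction (step s (A.trans (G.cong (B.sym eq)) (proj₂ (¬Stopper⇒InImage ¬s)))) ¬s
  match-injective (no ¬s) (no ¬s′) eq =
    A.trans (A.sym (proj₂ (¬Stopper⇒InImage ¬s)))
      (A.trans (G.cong eq) (proj₂ (¬Stopper⇒InImage ¬s′)))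

  -- The image of y under g cannot start a stopping orbit. If it is a stopper, its predecessor x
  -- satisfies f x ≈ y because g is injective; otherwise the image itself is matched with y.
  match-surjective : ∀ y → Dec (Stopper (G.to y)) →
                     ∃ λ x → ∀ (d : Dec (Stopper x)) → match x d B.≈ y
  match-surjective y (yes (start ∉im)) = contradiction (y , A.refl) ∉im
  match-surjective y (yes (step {x} s p)) = x , λ where
    (yes _) → G.injective p
    (no ¬s) → contradiction s ¬s
  match-surjective y (no ¬s) = G.to y , λ where
    (yes s)  → contradiction s ¬s
    (no ¬s′) → G.injective (proj₂ (¬Stopper⇒InImage ¬s′))

  bijection : Bijection A B
  bijection = record
    { to        = λ x → match x (em _)
    ; cong      = match-cong (em _) (em _)
    ; bijective = match-injective (em _) (em _) , λ y →
        let (x , hit) = match-surjective y (em _)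
        in x , λ {z} z≈x → B.trans (match-cong (em _) (em _) z≈x) (hit (em _))
    }

-- Coding terms by natural numbers

tag : Term → ℕ
tag (var _) = 0
tag (_ ∨ _) = 1
tag (_ · _) = 2
tag e       = 3

-- Opaque, so that the arguments of pair can be inferred from its value.
opaque

  pair : ℕ → ℕ → ℕ
  pair zero    n = suc (2 ℕ.* n)
  pair (suc m) n = 2 ℕ.* pair m n

  -- The value of `pair m n` is 2^m (2n + 1): parity tells a zero exponent from a positive one, and
  -- halving reduces the latter.
  pair-injective : ∀ {m n m′ n′} → pair m n ≡ pair m′ n′ → m ≡ m′ × n ≡ n′
  pair-injective {zero} {n} {zero} {n′} eq =
    refl , ℕ.*-cancelˡ-≡ n n′ 2 (ℕ.suc-injective eq)
  pair-injective {zero} {n} {suc m′} {n′} eq =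
    contradiction (sym eq) (ℕ.even≢odd (pair m′ n′) n)
  pair-injective {suc m} {n} {zero} {n′} eq =
    contradiction eq (ℕ.even≢odd (pair m n) n′)
  pair-injective {suc m} {_} {suc m′} eq =
    let (m≡m′ , n≡n′) = pair-injective (ℕ.*-cancelˡ-≡ (pair m _) (pair m′ _) 2 eq)
    in cong suc m≡m′ , n≡n′

code payload : Term → ℕ

code t = pair (tag t) (payload t)

payload (var i) = i
payload (s ∨ t) = pair (code s) (code t)
payload (s · t) = pair (code s) (code t)
payload e       = 0

code-injective : ∀ s t → code s ≡ code t → s ≡ t
-- Equal tags leave only the cases in which both terms have the same outermost constructor.
payload-injective : ∀ s t → tag s ≡ tag t → payload s ≡ payload t → s ≡ t

code-injective s t eq =
  let (p , q) = pair-injective eq in payload-injective s t p q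

payload-injective (var i)   (var j)   refl eq = cong var eq
payload-injective (s₁ ∨ s₂) (t₁ ∨ t₂) refl eq =
  let (p , q) = pair-injective eq
  in cong₂ _∨_ (code-injective s₁ t₁ p) (code-injective s₂ t₂ q)
payload-injective (s₁ · s₂) (t₁ · t₂) refl eq =
  let (p , q) = pair-injective eq
  in cong₂ _·_ (code-injective s₁ t₁ p) (code-injective s₂ t₂ q)
payload-injective e         e         refl eq = refl

-- Inequalities and their disjunctions in totally ordered groups

Inequality : Set
Inequality = Term × Term

asEquation : Inequality → Equation
asEquation (s , t) = s ∨ t , t

infixr 5 _or_

-- In a totally ordered group, s s′ ≤ t s′ ∨ s t′ holds iff s ≤ t or s′ ≤ t′.
_or_ : Inequality → Inequality → Inequality
(s , t) or (s′ , t′) = s · s′ , t · s′ ∨ s · t′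

module OrderedGroup
  {A : Set} {_∙_ : Op₂ A} {ε : A} {_⁻¹ : Op₁ A} (isGroup : IsGroup _≡_ _∙_ ε _⁻¹)
  {_<_ : Rel A 0ℓ} (isStrictTotalOrder : IsStrictTotalOrder _≡_ _<_)
  (∙-monoʳ-< : ∀ x {y z} → y < z → (x ∙ y) < (x ∙ z))
  (∙-monoˡ-< : ∀ x {y z} → y < z → (y ∙ x) < (z ∙ x))
  where

  private
    module G = IsGroup isGroup
    module O = IsStrictTotalOrder isStrictTotalOrder
    totalOrder : TotalOrder 0ℓ 0ℓ 0ℓ
    totalOrder = record
      { isTotalOrder = StrictToNonStrict.isTotalOrder _≡_ _<_ isStrictTotalOrder }
    module M = Max totalOrder
  open TotalOrder totalOrder using (_≤_)
  open M using (_⊔_)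

  private
    ≤⇒≯ : ∀ {x y} → x ≤ y → ¬ y < x
    ≤⇒≯ (inj₁ x<y)  y<x = O.asym x<y y<x
    ≤⇒≯ (inj₂ refl) y<x = O.irrefl refl y<x

    ≯⇒≤ : ∀ {x y} → ¬ y < x → x ≤ y
    ≯⇒≤ {x} {y} y≮x with O.compare x y
    ... | tri< x<y _ _ = inj₁ x<y
    ... | tri≈ _ x≡y _ = inj₂ x≡y
    ... | tri> _ _ y<x = contradiction y<x y≮x

    ⊔-< : ∀ {x y z} → x < z → y < z → (x ⊔ y) < z
    ⊔-< {x} {y} x<z y<z with M.⊔-sel x y
    ... | inj₁ eq = subst (_< _) (sym eq) x<z
    ... | inj₂ eq = subst (_< _) (sym eq) y<z

    ≤-<-trans : ∀ {x y z} → x ≤ y → y < z → x < z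
    ≤-<-trans (inj₁ x<y)  y<z = O.trans x<y y<z
    ≤-<-trans (inj₂ refl) y<z = y<z

    ∙-monoʳ-≤ : ∀ x {y z} → y ≤ z → (x ∙ y) ≤ (x ∙ z)
    ∙-monoʳ-≤ x = Sum.map (∙-monoʳ-< x) (cong (x ∙_))

    ∙-monoˡ-≤ : ∀ x {y z} → y ≤ z → (y ∙ x) ≤ (z ∙ x)
    ∙-monoˡ-≤ x = Sum.map (∙-monoˡ-< x) (cong (_∙ x))

    ∙-cancelʳ-< : ∀ x {y z} → (y ∙ x) < (z ∙ x) → y < z
    ∙-cancelʳ-< x {y} {z} yx<zx with O.compare y z
    ... | tri< y<z _ _ = y<z
    ... | tri≈ _ refl _ = contradiction yx<zx (O.irrefl refl)
    ... | tri> _ _ z<y = contradiction yx<zx (O.asym (∙-monoˡ-< x z<y))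

    ∙-cancelˡ-< : ∀ x {y z} → (x ∙ y) < (x ∙ z) → y < z
    ∙-cancelˡ-< x {y} {z} xy<xz with O.compare y z
    ... | tri< y<z _ _ = y<z
    ... | tri≈ _ refl _ = contradiction xy<xz (O.irrefl refl)
    ... | tri> _ _ z<y = contradiction xy<xz (O.asym (∙-monoʳ-< x z<y))

    distrib : ∀ a b c d → (a ∙ (b ⊔ c)) ∙ d ≡ ((a ∙ b) ∙ d) ⊔ ((a ∙ c) ∙ d)
    distrib a b c d =
      M.mono-≤-distrib-⊔ (cong λ x → (a ∙ x) ∙ d) (λ p → ∙-monoˡ-≤ d (∙-monoʳ-≤ a p)) b c

  eval : (ℕ → A) → Term → A
  eval ρ (var i) = ρ i
  eval ρ (s ∨ t) = eval ρ s ⊔ eval ρ t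
  eval ρ (s · t) = eval ρ s ∙ eval ρ t
  eval ρ e       = ε

  _Violates_ : (ℕ → A) → Inequality → Set
  ρ Violates (s , t) = eval ρ t < eval ρ s

  -- If both t s′ and s t′ lie below s s′, cancelling s′ on the right and s on the left gives t < s
  -- and t′ < s′. Conversely, the maximum of two elements below s s′ is below it.
  violates-or : ∀ ρ α β → ρ Violates (α or β) ⇔ (ρ Violates α × ρ Violates β)
  violates-or ρ (s , t) (s′ , t′) = mk⇔
    (λ viol → ∙-cancelʳ-< _ (≤-<-trans (M.x≤x⊔y _ _) viol)
            , ∙-cancelˡ-< _ (≤-<-trans (M.x≤y⊔x _ _) viol))
    (λ (viol , viol′) → ⊔-< (∙-monoˡ-< _ viol) (∙-monoʳ-< _ viol′))

  module _ (c ℓ : Level) where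

    -- The group lives at the lowest level; lifting provides a copy at every pair of levels.
    semifield : IdempotentSemifield c ℓ
    semifield = record
      { raw = raw
      ; isIdempotentSemifield = record
        { isIdempotentSemiring = record
          { ·-isMonoid = IsGroup.isMonoid lifted
          ; ∨-isSemilattice = record
            { isBand = record
              { isSemigroup = record
                { isMagma = record
                  { isEquivalence = IsGroup.isEquivalence lifted
                  ; ∙-cong = λ (lift p) (lift q) → lift (cong₂ _⊔_ p q)
                  }
                ; assoc = λ (lift x) (lift y) (lift z) → lift (M.⊔-assoc x y z)
                }
              ; idem = λ (lift x) → lift (M.⊔-idem x)
              }
            ; comm = λ (lift x) (lift y) → lift (M.⊔-comm x y)
            }
          ; distrib = λ (lift x) (lift y) (lift z) (lift w) → lift (distrib x y z w)
          }
        ; ·-isGroupReduct = (λ (lift x) → lift (x ⁻¹)) , lifted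
        }
      }
      where
      raw : RawIdempotentSemiring c ℓ
      raw = record
        { Carrier = Lift c A
        ; _≈_     = λ (lift x) (lift y) → Lift ℓ (x ≡ y)
        ; _∨_     = λ (lift x) (lift y) → lift (x ⊔ y)
        ; _·_     = λ (lift x) (lift y) → lift (x ∙ y)
        ; e       = lift ε
        }
      open RawIdempotentSemiring raw using (_≈_) renaming (_·_ to _·ᴸ_; e to eᴸ)
      lifted : IsGroup _≈_ _·ᴸ_ eᴸ (λ (lift x) → lift (x ⁻¹))
      lifted = record
        { isMonoid = record
          { isSemigroup = record
            { isMagma = record
              { isEquivalence = record
                { refl  = lift refl
                ; sym   = λ (lift p) → lift (sym p)
                ; trans = λ (lift p) (lift q) → lift (trans p q)
                }
              ; ∙-cong = λ (lift p) (lift q) → lift (cong₂ _∙_ p q)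
              }
            ; assoc = λ (lift x) (lift y) (lift z) → lift (G.assoc x y z)
            }
          ; identity = (λ (lift x) → lift (G.identityˡ x)) , λ (lift x) → lift (G.identityʳ x)
          }
        ; inverse = (λ (lift x) → lift (G.inverseˡ x)) , λ (lift x) → lift (G.inverseʳ x)
        ; ⁻¹-cong = λ (lift p) → lift (cong _⁻¹ p)
        }

    private
      open IdempotentSemifield semifield using (raw)

      eval-isHomomorphism : ∀ ρ → IsHomomorphism termAlgebra raw (λ t → lift (eval ρ t))
      eval-isHomomorphism ρ = record
        { ∨-isMagmaHomomorphism = record
          { isRelHomomorphism = record { cong = λ { refl → lift refl } }
          ; homo = λ _ _ → lift refl
          }
        ; ·-isMonoidHomomorphism = record
          { isMagmaHomomorphism = record
            { isRelHomomorphism = record { cong = λ { refl → lift refl } }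
            ; homo = λ _ _ → lift refl
            }
          ; ε-homo = lift refl
          }
        }

      homomorphism-eval : ∀ {φ} → IsHomomorphism termAlgebra raw φ →
                          ∀ t → lower (φ t) ≡ eval (λ i → lower (φ (var i))) t
      homomorphism-eval {φ} hom = go
        where
        module H = IsHomomorphism hom
        go : ∀ t → lower (φ t) ≡ eval (λ i → lower (φ (var i))) t
        go (var i) = refl
        go (s ∨ t) = trans (lower (IsMagmaHomomorphism.homo H.∨-isMagmaHomomorphism s t))
                           (cong₂ _⊔_ (go s) (go t))
        go (s · t) = trans (lower (IsMonoidHomomorphism.homo H.·-isMonoidHomomorphism s t))
                           (cong₂ _∙_ (go s) (go t))
        go e       = lower (IsMonoidHomomorphism.ε-homo H.·-isMonoidHomomorphism)

    ⊨⇔noViolation : ∀ α → semifield ⊨ asEquation α ⇔ (∀ ρ → ¬ ρ Violates α)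
    ⊨⇔noViolation (s , t) = mk⇔
      (λ sat ρ → ≤⇒≯ (M.x⊔y≈y⇒x≤y
        (lower (sat (λ t → lift (eval ρ t)) (eval-isHomomorphism ρ)))))
      (λ none φ hom → lift (trans (homomorphism-eval hom (s ∨ t))
        (trans (M.x≤y⇒x⊔y≈y (≯⇒≤ (none _))) (sym (homomorphism-eval hom t)))))

-- Order and powers in the rationals

open import Data.Rational.Base
  using (ℚ; 0ℚ; 1ℚ; _+_; _*_; _-_; -_; _<_; _≤_; 1/_; Positive; positive; nonNegative)
open import Data.Rational.Properties

private
  ℚ-semiring = CommutativeRing.semiring +-*-commutativeRing
open Exp ℚ-semiring using (_^_; ^-homo-*)
open Mult ℚ-semiring using (×1-homo-*) renaming (_×_ to _×′_)
open +-*-Solver using (solve; _:=_; _:+_; _:*_; _:-_; :-_; con)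

*-pos : ∀ {p q} → 0ℚ < p → 0ℚ < q → 0ℚ < p * q
*-pos {p} {q} 0<p 0<q =
  positive⁻¹ (p * q) {{pos*pos⇒pos p {{positive 0<p}} q {{positive 0<q}}}}

*-cancel-pos : ∀ {p q} → 0ℚ < p → 0ℚ < p * q → 0ℚ < q
*-cancel-pos {p} {q} 0<p 0<pq = *-cancelˡ-<-nonNeg p {{nonNegative (<⇒≤ 0<p)}}
  (subst (_< p * q) (sym (*-zeroʳ p)) 0<pq)

p<q⇒0<q-p : ∀ {p q} → p < q → 0ℚ < q - p
p<q⇒0<q-p {p} {q} p<q = subst (_< q - p) (+-inverseʳ p) (+-monoˡ-< (- p) p<q)

0<q-p⇒p<q : ∀ {p q} → 0ℚ < q - p → p < q
0<q-p⇒p<q {p} {q} 0<q-p = subst₂ _<_ (+-identityˡ p)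
  (solve 2 (λ p q → (q :- p) :+ p := q) refl p q) (+-monoˡ-< p 0<q-p)

fromℕ : ℕ → ℚ
fromℕ n = n ×′ 1ℚ

fromℕ-mono-< : ∀ {m n} → m ℕ.< n → fromℕ m < fromℕ n
fromℕ-mono-≤ : ∀ {m n} → m ℕ.≤ n → fromℕ m ≤ fromℕ n

fromℕ-mono-< {n = suc n} (s≤s m≤n) = ≤-<-trans (fromℕ-mono-≤ m≤n)
  (subst (_< fromℕ (suc n)) (+-identityˡ (fromℕ n)) (+-monoˡ-< (fromℕ n) (positive⁻¹ 1ℚ)))
fromℕ-mono-≤ m≤n with ℕ.m≤n⇒m<n∨m≡n m≤n
... | inj₂ refl = ≤-refl
... | inj₁ m<n  = <⇒≤ (fromℕ-mono-< m<n)

fromℕ-cancel-< : ∀ {m n} → fromℕ m < fromℕ n → m ℕ.< n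
fromℕ-cancel-< {m} {n} p with m ℕ.<? n
... | yes m<n = m<n
... | no  m≮n = contradiction p (≤⇒≯ (fromℕ-mono-≤ (ℕ.≮⇒≥ m≮n)))
  where
  ≤⇒≯ : ∀ {p q} → q ≤ p → ¬ p < q
  ≤⇒≯ q≤p p<q = <-irrefl refl (<-≤-trans p<q q≤p)

fromℕ-^ : ∀ m n → fromℕ (m ℕ.^ n) ≡ fromℕ m ^ n
fromℕ-^ m zero    = refl
fromℕ-^ m (suc n) = trans (×1-homo-* m (m ℕ.^ n)) (cong (fromℕ m *_) (fromℕ-^ m n))

-- The separating equations

power : Term → ℕ → Term
power t zero    = e
power t (suc n) = t · power t n

-- Moving a translation from the right of `w` to its left multiplies it by the slope of `w`, while
-- the n-th power multiplies it by n. For translations `u` and `v` this therefore compares the slope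
-- of `w` with n.
growth : ℕ → Term → Term → Term → Inequality
growth n u v w = power v n · w · u , power u n · w · v

modulus : ℕ → ℕ
modulus n = 2 ℕ.+ 4 ℕ.* n

xy yx x : Term
x  = var 0
xy = var 0 · var 1
yx = var 1 · var 0

-- Violated together, these two force xy and yx to have slope 1.
short long : Inequality
short = xy · xy · yx , yx · yx · xy
long  = yx · xy · xy , xy · yx · yx

-- The bounds are `modulus n` minus and plus one. Exchanging `xy` and `yx` changes the sign of the
-- difference of the translations, which reverses the comparison.
lowerBound upperBound : ℕ → Inequality
lowerBound n = growth (1 ℕ.+ 4 ℕ.* n) xy yx x
upperBound n = growth (3 ℕ.+ 4 ℕ.* n) yx xy x

separator : ℕ → Inequality
separator n = short or long or lowerBound n or upperBound n

-- The larger root of 1 + s - s² is the golden ratio, which is below 2. Rewriting the polynomial as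
-- (2 - s)(1 + s) - 1 avoids the irrational root.
square>1+ : ∀ {s} → fromℕ 2 ≤ s → ¬ 0ℚ < 1ℚ + s - s * s
square>1+ {s} 2≤s 0<1+s-s² = <-irrefl refl (begin-strict
  0ℚ                                       <⟨ 0<1+s-s² ⟩
  1ℚ + s - s * s                           ≡⟨ solve 1 (λ s → con 1ℚ :+ s :- s :* s :=
                                                (con (fromℕ 2) :- s) :* (con 1ℚ :+ s) :- con 1ℚ) refl s ⟩
  (fromℕ 2 - s) * (1ℚ + s) - 1ℚ            ≤⟨ +-monoˡ-≤ (- 1ℚ) scaled ⟩
  0ℚ * (1ℚ + s) - 1ℚ                       ≡⟨ cong (_- 1ℚ) (*-zeroˡ (1ℚ + s)) ⟩
  0ℚ - 1ℚ                                  <⟨ negative⁻¹ (0ℚ - 1ℚ) ⟩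
  0ℚ                                       ∎)
  where
  open ≤-Reasoning
  0≤1+s : 0ℚ ≤ 1ℚ + s
  0≤1+s = ≤-trans (<⇒≤ (positive⁻¹ (1ℚ + fromℕ 2))) (+-monoʳ-≤ 1ℚ 2≤s)
  2-s≤0 : fromℕ 2 - s ≤ 0ℚ
  2-s≤0 = subst (fromℕ 2 - s ≤_) (+-inverseʳ s) (+-monoˡ-≤ (- s) 2≤s)
  scaled : (fromℕ 2 - s) * (1ℚ + s) ≤ 0ℚ * (1ℚ + s)
  scaled = *-monoʳ-≤-nonNeg (1ℚ + s) {{nonNegative 0≤1+s}} 2-s≤0

-- The ordered group of affine maps with slopes the powers of g

module Affine (g : ℚ) (2≤g : fromℕ 2 ≤ g) where

  private
    0<g : 0ℚ < g
    0<g = <-≤-trans (positive⁻¹ (fromℕ 2)) 2≤g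

    instance
      g-positive : Positive g
      g-positive = positive 0<g

    h : ℚ
    h = (1/ g) {{pos⇒nonZero g}}

    gh≡1 : g * h ≡ 1ℚ
    gh≡1 = *-inverseʳ g {{pos⇒nonZero g}}

    0<h : 0ℚ < h
    0<h = positive⁻¹ h {{1/pos⇒pos g}}

    ^-pos : ∀ {p} → 0ℚ < p → ∀ n → 0ℚ < p ^ n
    ^-pos 0<p zero    = positive⁻¹ 1ℚ
    ^-pos 0<p (suc n) = *-pos 0<p (^-pos 0<p n)

  slope : ℤ → ℚ
  slope (+ n)    = g ^ n
  slope -[1+ n ] = h ^ suc n

  slope-pos : ∀ k → 0ℚ < slope k
  slope-pos (+ n)    = ^-pos 0<g n
  slope-pos -[1+ n ] = ^-pos 0<h (suc n)

  slope-⊖ : ∀ m n → slope (m ⊖ n) ≡ g ^ m * h ^ n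
  slope-⊖ zero    zero    = refl
  slope-⊖ zero    (suc n) = sym (*-identityˡ _)
  slope-⊖ (suc m) zero    = sym (*-identityʳ _)
  slope-⊖ (suc m) (suc n) = begin
    slope (suc m ⊖ suc n)        ≡⟨ cong slope (ℤ.[1+m]⊖[1+n]≡m⊖n m n) ⟩
    slope (m ⊖ n)                ≡⟨ slope-⊖ m n ⟩
    g ^ m * h ^ n                ≡⟨ *-identityˡ _ ⟨
    1ℚ * (g ^ m * h ^ n)         ≡⟨ cong (_* (g ^ m * h ^ n)) gh≡1 ⟨
    g * h * (g ^ m * h ^ n)      ≡⟨ solve 4 (λ a b c d → a :* b :* (c :* d) := (a :* c) :* (b :* d))
                                      refl g h (g ^ m) (h ^ n) ⟩
    g ^ suc m * h ^ suc n        ∎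
    where open ≡-Reasoning

  slope-+ : ∀ k l → slope (k ℤ.+ l) ≡ slope k * slope l
  slope-+ (+ m)    (+ n)    = ^-homo-* g m n
  slope-+ (+ m)    -[1+ n ] = slope-⊖ m (suc n)
  slope-+ -[1+ m ] (+ n)    = trans (slope-⊖ n (suc m)) (*-comm (g ^ n) _)
  slope-+ -[1+ m ] -[1+ n ] =
    trans (cong (λ i → h ^ suc i) (sym (ℕ.+-suc m n))) (^-homo-* h (suc m) (suc n))

  slope-inverseʳ : ∀ k → slope k * slope (ℤ.- k) ≡ 1ℚ
  slope-inverseʳ k = trans (sym (slope-+ k (ℤ.- k))) (cong slope (ℤ.+-inverseʳ k))

  slope≥2 : ∀ n → fromℕ 2 ≤ slope (+ suc n)
  slope≥2 zero    = subst (fromℕ 2 ≤_) (sym (*-identityʳ g)) 2≤g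
  slope≥2 (suc n) = ≤-trans (slope≥2 n)
    (subst (_≤ slope (+ suc (suc n))) (*-identityˡ (slope (+ suc n)))
      (*-monoʳ-≤-nonNeg (slope (+ suc n)) {{nonNegative (<⇒≤ (slope-pos (+ suc n)))}}
        (≤-trans (<⇒≤ (fromℕ-mono-< {1} {2} (s≤s (s≤s z≤n)))) 2≤g)))

  -- (k , b) is the affine map x ↦ gᵏ x + b.
  Map : Set
  Map = ℤ × ℚ

  infixl 7 _∙_
  _∙_ : Map → Map → Map
  (k , b) ∙ (l , c) = k ℤ.+ l , b + slope k * c

  ε : Map
  ε = 0ℤ , 0ℚ

  _⁻¹ : Map → Map
  (k , b) ⁻¹ = ℤ.- k , - (slope (ℤ.- k) * b)

  infix 4 _⊏_
  _⊏_ : Rel Map 0ℓ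
  _⊏_ = ×-Lex _≡_ ℤ._<_ _<_

  isGroup : IsGroup _≡_ _∙_ ε _⁻¹
  isGroup = record
    { isMonoid = record
      { isSemigroup = record
        { isMagma = record { isEquivalence = isEquivalence ; ∙-cong = cong₂ _∙_ }
        ; assoc = assoc
        }
      ; identity = (λ (k , b) → cong₂ _,_ (ℤ.+-identityˡ k)
                       (solve 1 (λ b → con 0ℚ :+ con 1ℚ :* b := b) refl b))
                 , (λ (k , b) → cong₂ _,_ (ℤ.+-identityʳ k)
                       (solve 2 (λ s b → b :+ s :* con 0ℚ := b) refl (slope k) b))
      }
    ; inverse = (λ (k , b) → cong₂ _,_ (ℤ.+-inverseˡ k) (+-inverseˡ (slope (ℤ.- k) * b)))
              , inverseʳ
    ; ⁻¹-cong = cong _⁻¹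
    }
    where
    assoc : ∀ x y z → (x ∙ y) ∙ z ≡ x ∙ (y ∙ z)
    assoc (k , b) (l , c) (m , d) = cong₂ _,_ (ℤ.+-assoc k l m)
      (trans (cong (λ s → b + slope k * c + s * d) (slope-+ k l))
        (solve 5 (λ b s c t d → b :+ s :* c :+ s :* t :* d := b :+ s :* (c :+ t :* d))
          refl b (slope k) c (slope l) d))

    inverseʳ : ∀ x → x ∙ (x ⁻¹) ≡ ε
    inverseʳ (k , b) = cong₂ _,_ (ℤ.+-inverseʳ k) (begin
      b + slope k * - (slope (ℤ.- k) * b)
        ≡⟨ solve 3 (λ b s t → b :+ s :* :- (t :* b) := b :- s :* t :* b)
             refl b (slope k) (slope (ℤ.- k)) ⟩
      b - slope k * slope (ℤ.- k) * b
        ≡⟨ cong (λ u → b - u * b) (slope-inverseʳ k) ⟩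
      b - 1ℚ * b
        ≡⟨ solve 1 (λ b → b :- con 1ℚ :* b := con 0ℚ) refl b ⟩
      0ℚ ∎)
      where open ≡-Reasoning

  isStrictTotalOrder : IsStrictTotalOrder _≡_ _⊏_
  isStrictTotalOrder = record
    { isStrictPartialOrder = record
      { isEquivalence = isEquivalence
      ; irrefl = λ { refl (inj₁ k<k)       → ℤ.<-irrefl refl k<k
                   ; refl (inj₂ (_ , b<b)) → <-irrefl refl b<b }
      ; trans = ×-transitive {_<₂_ = _<_} isEquivalence (subst _ , λ {refl p → p}) ℤ.<-trans <-trans
      ; <-resp-≈ = (λ { refl p → p }) , (λ { refl p → p })
      }
    ; compare = compare
    }
    where
    compare : Trichotomous _≡_ _⊏_
    compare x y with ×-compare {_<₂_ = _<_} sym ℤ.<-cmp <-cmp x y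
    ... | tri< x<y x≉y y≮x = tri< x<y (λ { refl → x≉y (refl , refl) }) y≮x
    ... | tri≈ x≮y x≈y y≮x = tri≈ x≮y (cong₂ _,_ (proj₁ x≈y) (proj₂ x≈y)) y≮x
    ... | tri> x≮y x≉y y<x = tri> x≮y (λ { refl → x≉y (refl , refl) }) y<x

  -- Between maps of equal slope, left multiplication scales the difference of the constant parts by
  -- a positive slope.
  ∙-monoʳ-⊏ : ∀ x {y z} → y ⊏ z → x ∙ y ⊏ x ∙ z
  ∙-monoʳ-⊏ (k , b) (inj₁ l<m) = inj₁ (ℤ.+-monoʳ-< k l<m)
  ∙-monoʳ-⊏ (k , b) (inj₂ (refl , c<d)) =
    inj₂ (refl , +-monoʳ-< b (*-monoʳ-<-pos (slope k) {{positive (slope-pos k)}} c<d))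

  ∙-monoˡ-⊏ : ∀ x {y z} → y ⊏ z → y ∙ x ⊏ z ∙ x
  ∙-monoˡ-⊏ (k , b) (inj₁ l<m)          = inj₁ (ℤ.+-monoˡ-< k l<m)
  ∙-monoˡ-⊏ (k , b) (inj₂ (refl , c<d)) = inj₂ (refl , +-monoˡ-< _ c<d)

  open OrderedGroup isGroup isStrictTotalOrder ∙-monoʳ-⊏ ∙-monoˡ-⊏ public

  -- Violations of the separators by affine maps

  ⊏-sameSlope : ∀ {x y} → proj₁ x ≡ proj₁ y → x ⊏ y → proj₂ x < proj₂ y
  ⊏-sameSlope k≡l (inj₁ k<l)       = contradiction k<l (ℤ.<-irrefl k≡l)
  ⊏-sameSlope k≡l (inj₂ (_ , b<c)) = b<c

  -- The hypotheses place the slope strictly between the inverse of the golden ratio and the golden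
  -- ratio, and the powers of g ≥ 2 meet this interval only in 1. For a negative exponent,
  -- multiplying the second hypothesis by the square of the inverse slope yields the first one for
  -- that inverse.
  slope-one : ∀ k → 0ℚ < 1ℚ + slope k - slope k * slope k →
              0ℚ < slope k + slope k * slope k - 1ℚ → k ≡ 0ℤ
  slope-one (+ zero)  _ _ = refl
  slope-one (+ suc n) 0<1+s-s² _ = contradiction 0<1+s-s² (square>1+ (slope≥2 n))
  slope-one -[1+ n ]  _ 0<s+s²-1 = contradiction
    (subst (0ℚ <_) scaled (*-pos (*-pos 0<t 0<t) 0<s+s²-1)) (square>1+ (slope≥2 n))
    where
    open ≡-Reasoning
    s t : ℚ
    s = slope -[1+ n ]
    t = slope (+ suc n)
    0<t : 0ℚ < t
    0<t = slope-pos (+ suc n)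
    scaled : t * t * (s + s * s - 1ℚ) ≡ 1ℚ + t - t * t
    scaled = begin
      t * t * (s + s * s - 1ℚ)
        ≡⟨ solve 2 (λ s t → t :* t :* (s :+ s :* s :- con 1ℚ) :=
             (s :* t) :* (s :* t) :+ (s :* t) :* t :- t :* t) refl s t ⟩
      (s * t) * (s * t) + (s * t) * t - t * t
        ≡⟨ cong (λ u → u * u + u * t - t * t) (slope-inverseʳ -[1+ n ]) ⟩
      1ℚ * 1ℚ + 1ℚ * t - t * t
        ≡⟨ solve 1 (λ t → con 1ℚ :* con 1ℚ :+ con 1ℚ :* t :- t :* t :=
             con 1ℚ :+ t :- t :* t) refl t ⟩
      1ℚ + t - t * t ∎

  -- With common slope s the two hypotheses become (1 + s - s²)(p - r) > 0 and (s + s² - 1)(p - r) >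
  -- 0. Their sum 2s(p - r) shows p > r, so both first factors are positive and `slope-one` applies.
  balanced : ∀ {k p l r} → k ≡ l → let u = (k , p) ; v = (l , r) in
             v ∙ v ∙ u ⊏ u ∙ u ∙ v → u ∙ v ∙ v ⊏ v ∙ u ∙ u → k ≡ 0ℤ × 0ℚ < p - r
  balanced {k} {p} {r = r} refl vvu<uuv uvv<vuu =
    slope-one k (*-cancel-pos 0<d (subst (0ℚ <_) (*-comm (1ℚ + s - s * s) (p - r)) ineq₁))
                (*-cancel-pos 0<d (subst (0ℚ <_) (*-comm (s + s * s - 1ℚ) (p - r)) ineq₂))
    , 0<d
    where
    s : ℚ
    s = slope k
    ineq₁ : 0ℚ < (1ℚ + s - s * s) * (p - r)
    ineq₁ = subst (0ℚ <_)
      (trans (cong (λ t → (p + s * p + t * r) - (r + s * r + t * p)) (slope-+ k k))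
        (solve 3 (λ s p r → (p :+ s :* p :+ s :* s :* r) :- (r :+ s :* r :+ s :* s :* p) :=
          (con 1ℚ :+ s :- s :* s) :* (p :- r)) refl s p r))
      (p<q⇒0<q-p (⊏-sameSlope refl vvu<uuv))
    ineq₂ : 0ℚ < (s + s * s - 1ℚ) * (p - r)
    ineq₂ = subst (0ℚ <_)
      (trans (cong (λ t → (r + s * p + t * p) - (p + s * r + t * r)) (slope-+ k k))
        (solve 3 (λ s p r → (r :+ s :* p :+ s :* s :* p) :- (p :+ s :* r :+ s :* s :* r) :=
          (s :+ s :* s :- con 1ℚ) :* (p :- r)) refl s p r))
      (p<q⇒0<q-p (⊏-sameSlope refl uvv<vuu))
    0<d : 0ℚ < p - r
    0<d = *-cancel-pos (*-pos (positive⁻¹ (fromℕ 2)) (slope-pos k))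
      (subst (0ℚ <_)
        (solve 3 (λ s p r → (con 1ℚ :+ s :- s :* s) :* (p :- r) :+ (s :+ s :* s :- con 1ℚ) :* (p :- r) :=
          con (fromℕ 2) :* s :* (p :- r)) refl s p r)
        (+-mono-< ineq₁ ineq₂))

  eval-power : ∀ ρ t n {p} → eval ρ t ≡ (0ℤ , p) → eval ρ (power t n) ≡ (0ℤ , fromℕ n * p)
  eval-power ρ t zero    {p} eq = cong (0ℤ ,_) (sym (*-zeroˡ p))
  eval-power ρ t (suc n) {p} eq = trans (cong₂ _∙_ eq (eval-power ρ t n eq)) (cong (0ℤ ,_)
    (solve 2 (λ m p → p :+ con 1ℚ :* (m :* p) := (con 1ℚ :+ m) :* p) refl (fromℕ n) p))

  -- Both sides have the slope of `w`, so the order compares their constant parts, and the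
  -- contribution of `w` to these cancels.
  violates-growth : ∀ ρ n u v w {p r} → eval ρ u ≡ (0ℤ , p) → eval ρ v ≡ (0ℤ , r) →
    ρ Violates growth n u v w ⇔ 0ℚ < (slope (proj₁ (eval ρ w)) - fromℕ n) * (p - r)
  violates-growth ρ n u v w {p} {r} eqᵤ eqᵥ = mk⇔
    (λ viol → subst (0ℚ <_) difference
      (p<q⇒0<q-p (⊏-sameSlope refl (subst₂ _⊏_ value₁ value₂ viol))))
    (λ 0<d → subst₂ _⊏_ (sym value₁) (sym value₂)
      (inj₂ (refl , 0<q-p⇒p<q (subst (0ℚ <_) (sym difference) 0<d))))
    where
    k = proj₁ (eval ρ w)
    b = proj₂ (eval ρ w)
    m = fromℕ n

    value : ∀ u v {p r} → eval ρ u ≡ (0ℤ , p) → eval ρ v ≡ (0ℤ , r) →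
            eval ρ (power u n · w · v) ≡ (k , m * p + b + slope k * r)
    value u v {p} {r} eqᵤ eqᵥ = begin
      eval ρ (power u n) ∙ (k , b) ∙ eval ρ v
        ≡⟨ cong₂ (λ y z → y ∙ (k , b) ∙ z) (eval-power ρ u n eqᵤ) eqᵥ ⟩
      0ℤ ℤ.+ k ℤ.+ 0ℤ , m * p + 1ℚ * b + slope (0ℤ ℤ.+ k) * r
        ≡⟨ cong₂ _,_ (trans (ℤ.+-identityʳ (0ℤ ℤ.+ k)) (ℤ.+-identityˡ k))
             (cong₂ (λ b l → m * p + b + slope l * r) (*-identityˡ b) (ℤ.+-identityˡ k)) ⟩
      k , m * p + b + slope k * r ∎
      where open ≡-Reasoning
    value₁ = value u v eqᵤ eqᵥ
    value₂ = value v u eqᵥ eqᵤ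

    difference : (m * r + b + slope k * p) - (m * p + b + slope k * r) ≡ (slope k - m) * (p - r)
    difference = solve 5 (λ m b s p r → (m :* r :+ b :+ s :* p) :- (m :* p :+ b :+ s :* r) :=
      (s :- m) :* (p :- r)) refl m b (slope k) p r

  violates-separator : ∀ ρ n → ρ Violates separator n ⇔
    ((ρ Violates short × ρ Violates long) × ρ Violates lowerBound n × ρ Violates upperBound n)
  violates-separator ρ n = mk⇔
    (λ viol → let (viol₁ , viol₂₃₄) = to   or₁ viol
                  (viol₂ , viol₃₄)  = to   or₂ viol₂₃₄
              in (viol₁ , viol₂) , to or₃ viol₃₄)
    (λ ((viol₁ , viol₂) , viol₃₄) → from or₁ (viol₁ , from or₂ (viol₂ , from or₃ viol₃₄)))
    where
    or₁ = violates-or ρ short (long or lowerBound n or upperBound n)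
    or₂ = violates-or ρ long (lowerBound n or upperBound n)
    or₃ = violates-or ρ (lowerBound n) (upperBound n)

  violated-slope : ∀ ρ n → ρ Violates separator n →
    ∃ λ k → fromℕ (1 ℕ.+ 4 ℕ.* n) < slope k × slope k < fromℕ (3 ℕ.+ 4 ℕ.* n)
  violated-slope ρ n viol = k
    , 0<q-p⇒p<q (*-cancel-pos 0<d (subst (0ℚ <_) (*-comm (slope k - fromℕ l) (p - r))
        (to (violates-growth ρ l xy yx x eq₁ eq₂) viol₃)))
    , 0<q-p⇒p<q (*-cancel-pos 0<d (subst (0ℚ <_)
        (solve 4 (λ s m p r → (s :- m) :* (r :- p) := (p :- r) :* (m :- s))
          refl (slope k) (fromℕ u) p r)
        (to (violates-growth ρ u yx xy x eq₂ eq₁) viol₄)))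
    where
    l = 1 ℕ.+ 4 ℕ.* n
    u = 3 ℕ.+ 4 ℕ.* n
    k = proj₁ (ρ 0)
    p = proj₂ (eval ρ xy)
    r = proj₂ (eval ρ yx)
    viols = to (violates-separator ρ n) viol
    viol₃ = proj₁ (proj₂ viols)
    viol₄ = proj₂ (proj₂ viols)
    -- The values of `xy` and `yx` always have equal slopes, since exponents add commutatively.
    comm = ℤ.+-comm k (proj₁ (ρ 1))
    bal = balanced {p = p} {r = r} comm (proj₁ (proj₁ viols)) (proj₂ (proj₁ viols))
    0<d = proj₂ bal
    eq₁ = cong (_, p) (proj₁ bal)
    eq₂ = cong (_, r) (trans (sym comm) (proj₁ bal))

  -- xy and yx become the translations by g and by 1.
  assignment : ℕ → Map
  assignment 0       = 1ℤ , 0ℚ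
  assignment 1       = -1ℤ , 1ℚ
  -- The separators contain only the variables 0 and 1, so any value serves here.
  assignment (suc _) = ε

  assignment-violates : ∀ n → fromℕ (1 ℕ.+ 4 ℕ.* n) < g → g < fromℕ (3 ℕ.+ 4 ℕ.* n) →
                        assignment Violates separator n
  assignment-violates n l<g g<u = from (violates-separator assignment n)
    ((  inj₂ (refl , 0<q-p⇒p<q (subst (0ℚ <_)
          (solve 2 (λ p r → p :- r := (p :+ con 1ℚ :* p :+ con 1ℚ :* r) :-
             (r :+ con 1ℚ :* r :+ con 1ℚ :* p)) refl p r) 0<d))
      , inj₂ (refl , 0<q-p⇒p<q (subst (0ℚ <_)
          (solve 2 (λ p r → p :- r := (r :+ con 1ℚ :* p :+ con 1ℚ :* p) :-
             (p :+ con 1ℚ :* r :+ con 1ℚ :* r)) refl p r) 0<d)))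
    , from (violates-growth assignment (1 ℕ.+ 4 ℕ.* n) xy yx x refl refl)
        (*-pos (p<q⇒0<q-p l<s) 0<d)
    , from (violates-growth assignment (3 ℕ.+ 4 ℕ.* n) yx xy x refl refl)
        (subst (0ℚ <_)
          (solve 4 (λ s m p r → (m :- s) :* (p :- r) := (s :- m) :* (r :- p))
            refl s (fromℕ (3 ℕ.+ 4 ℕ.* n)) p r)
          (*-pos (p<q⇒0<q-p s<u) 0<d)))
    where
    s = slope 1ℤ
    p = proj₂ (eval assignment xy)
    r = proj₂ (eval assignment yx)
    l<s = subst (fromℕ (1 ℕ.+ 4 ℕ.* n) <_) (sym (*-identityʳ g)) l<g
    s<u = subst (_< fromℕ (3 ℕ.+ 4 ℕ.* n)) (sym (*-identityʳ g)) g<u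
    0<d : 0ℚ < p - r
    -- The difference of the two translations is g - 1.
    0<d = subst (0ℚ <_)
      (solve 2 (λ s t → s :- con 1ℚ := (con 0ℚ :+ s :* con 1ℚ) :- (con 1ℚ :+ t :* con 0ℚ))
        refl s (slope -1ℤ))
      (p<q⇒0<q-p (<-≤-trans (fromℕ-mono-< {1} {2} (s≤s (s≤s z≤n))) (slope≥2 0)))

-- The models and the separators they satisfy

-- 4n + 2 is not divisible by 4, so it is not a proper power of an even number.
modulus-power : ∀ m n j → modulus m ℕ.^ j ≡ modulus n → m ≡ n
modulus-power m n 1 eq =
  ℕ.*-cancelˡ-≡ m n 4 (ℕ.+-cancelˡ-≡ 2 _ _ (trans (sym (ℕ.*-identityʳ (modulus m))) eq))
modulus-power m n (suc (suc j)) eq =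
  contradiction (ℕ.*-cancelˡ-≡ (2 ℕ.* z) (suc (2 ℕ.* n)) 2 (begin
    2 ℕ.* (2 ℕ.* z)                                 ≡⟨ fourfold m (modulus m ℕ.^ j) ⟩
    modulus m ℕ.* (modulus m ℕ.* modulus m ℕ.^ j)   ≡⟨ eq ⟩
    2 ℕ.+ 4 ℕ.* n                                   ≡⟨ twofold n ⟩
    2 ℕ.* suc (2 ℕ.* n)                             ∎))
    (ℕ.even≢odd z n)
  where
  open ≡-Reasoning
  z : ℕ
  -- Each of the two leading factors `modulus m` is twice `1 + 2m`, so this is a quarter of the
  -- power.
  z = (1 ℕ.+ 2 ℕ.* m) ℕ.* (1 ℕ.+ 2 ℕ.* m) ℕ.* modulus m ℕ.^ j
  fourfold : ∀ m y → 2 ℕ.* (2 ℕ.* ((1 ℕ.+ 2 ℕ.* m) ℕ.* (1 ℕ.+ 2 ℕ.* m) ℕ.* y)) ≡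
                     (2 ℕ.+ 4 ℕ.* m) ℕ.* ((2 ℕ.+ 4 ℕ.* m) ℕ.* y)
  fourfold = solve-∀
  twofold : ∀ n → 2 ℕ.+ 4 ℕ.* n ≡ 2 ℕ.* suc (2 ℕ.* n)
  twofold = solve-∀

module Model (m : ℕ) where

  open Affine (fromℕ (modulus m)) (fromℕ-mono-≤ (ℕ.m≤m+n 2 (4 ℕ.* m))) public

  -- The only integer in the open interval is `modulus n`, which settles nonnegative exponents by
  -- `modulus-power`. For a negative exponent the slope and its inverse would both exceed 1.
  slope-between : ∀ n k → fromℕ (1 ℕ.+ 4 ℕ.* n) < slope k → slope k < fromℕ (3 ℕ.+ 4 ℕ.* n) →
                  m ≡ n
  slope-between n (+ j) l<s s<u = modulus-power m n j (ℕ.≤-antisym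
    (ℕ.s≤s⁻¹ (fromℕ-cancel-< (subst (_< fromℕ (3 ℕ.+ 4 ℕ.* n)) (sym (fromℕ-^ (modulus m) j)) s<u)))
    (fromℕ-cancel-< (subst (fromℕ (1 ℕ.+ 4 ℕ.* n) <_) (sym (fromℕ-^ (modulus m) j)) l<s)))
  slope-between n -[1+ j ] l<s s<u = contradiction (slope-inverseʳ -[1+ j ])
    (<⇒≢ (begin-strict
      1ℚ           <⟨ 1<t ⟩
      t            ≡⟨ *-identityˡ t ⟨
      1ℚ * t       <⟨ *-monoˡ-<-pos t {{positive (slope-pos (+ suc j))}} 1<s ⟩
      slope -[1+ j ] * t ∎) ∘ sym)
    where
    open ≤-Reasoning
    t : ℚ
    t = slope (+ suc j)
    1<t : 1ℚ < t
    1<t = <-≤-trans (fromℕ-mono-< {1} {2} ℕ.≤-refl) (slope≥2 j)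
    1<s : 1ℚ < slope -[1+ j ]
    1<s = ≤-<-trans (fromℕ-mono-≤ {1} {1 ℕ.+ 4 ℕ.* n} (s≤s z≤n)) l<s

module _ (c ℓ : Level) where

  model : ℕ → IdempotentSemifield c ℓ
  model m = semifield c ℓ where open Model m

  model-⊨ : ∀ {m n} → m ≢ n → model m ⊨ asEquation (separator n)
  model-⊨ {m} {n} m≢n = from (⊨⇔noViolation c ℓ (separator n)) λ ρ viol →
    let (k , l<s , s<u) = violated-slope ρ n viol
    in m≢n (slope-between n k l<s s<u)
    where open Model m

  model-⊭ : ∀ n → ¬ model n ⊨ asEquation (separator n)
  model-⊭ n sat = to (⊨⇔noViolation c ℓ (separator n)) sat assignment
    (assignment-violates n
      (fromℕ-mono-< {1 ℕ.+ 4 ℕ.* n} {modulus n} ℕ.≤-refl)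
      (fromℕ-mono-< {modulus n} {3 ℕ.+ 4 ℕ.* n} ℕ.≤-refl))
    where open Model n

-- Injections between sets of natural numbers and equational theories

T-⇔⇒≡ : ∀ {x y} → T x ⇔ T y → x ≡ y
T-⇔⇒≡ eq = ⇔→≡ {z = true} (mk⇔ (to T-≡ ∘ to eq ∘ from T-≡) (to T-≡ ∘ from eq ∘ from T-≡))

module _ (em : ∀ a → ExcludedMiddle a) (c ℓ k : Level) where

  private
    Satisfies : IdempotentSemifield c ℓ → (ℕ → Bool) → Set _
    Satisfies A S = ∀ n → T (S n) → A ⊨ asEquation (separator n)

  -- Excluded middle brings the class from level c ⊔ ℓ to the prescribed level k.
  modelsOf : (ℕ → Bool) → Class c ℓ k
  modelsOf S A = Lift k (True (em _ {P = Satisfies A S}))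

  -- If n is not in S, then `model c ℓ n` satisfies all separators with index in S and so belongs to
  -- the class, but it refutes the n-th one.
  separator∈Eq : ∀ S n → T (S n) ⇔ asEquation (separator n) ∈ Eq (modelsOf S)
  separator∈Eq S n = mk⇔
    (λ n∈S A (lift A∈K) → toWitness A∈K n n∈S)
    (λ valid → decidable-stable (T? (S n)) λ n∉S →
      model-⊭ c ℓ n (valid (model c ℓ n) (lift (fromWitness λ m m∈S →
        model-⊨ c ℓ λ n≡m → n∉S (subst (T ∘ S) (sym n≡m) m∈S)))))

  Eq-resp : ∀ {S S′} → (∀ n → S n ≡ S′ n) → ∀ {α} → α ∈ Eq (modelsOf S) → α ∈ Eq (modelsOf S′)
  Eq-resp S≗S′ valid A (lift A∈K) = valid A (lift (fromWitness λ n n∈S →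
    toWitness A∈K n (subst T (S≗S′ n) n∈S)))

  theory : Injection (ℕ →-setoid Bool) (EquationalTheories c ℓ k)
  theory = record
    { to        = λ S → Eq (modelsOf S) , modelsOf S , (λ p → p) , (λ p → p)
    ; cong      = λ S≗S′ → Eq-resp S≗S′ , Eq-resp (sym ∘ S≗S′)
    ; injective = λ {S} {S′} (to⊆ , from⊆) n → T-⇔⇒≡ (mk⇔
        (from (separator∈Eq S′ n) ∘ to⊆ ∘ to (separator∈Eq S n))
        (from (separator∈Eq S n) ∘ from⊆ ∘ to (separator∈Eq S′ n)))
    }

  Codes : ∀ {a} → Pred Equation a → ℕ → Set a
  Codes E n = ∃ λ ((s , t) : Equation) → pair (code s) (code t) ≡ n × E (s , t)

  Codes-resp : ∀ {a} {E E′ : Pred Equation a} → (∀ {α} → E α → E′ α) →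
               ∀ {n} → Codes E n → Codes E′ n
  Codes-resp E⊆E′ (α , eq , α∈E) = α , eq , E⊆E′ α∈E

  -- The code of an equation in E is also the code of some equation in E′, and injectivity of the
  -- coding identifies the two equations.
  reflects : ∀ {a} {E E′ : Pred Equation a} →
             (∀ n → ⌊ em _ {P = Codes E n} ⌋ ≡ ⌊ em _ {P = Codes E′ n} ⌋) →
             ∀ {α} → E α → E′ α
  reflects eqs {s , t} α∈E
    with ((s′ , t′) , eq , α∈E′) ←
           toWitness (subst T (eqs (pair (code s) (code t))) (fromWitness ((s , t) , refl , α∈E)))
    with (p , q) ← pair-injective eq
    with refl ← code-injective s′ s p | refl ← code-injective t′ t q = α∈E′

  characteristic : Injection (EquationalTheories c ℓ k) (ℕ →-setoid Bool)
  characteristic = record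
    { to        = λ (E , _) n → ⌊ em _ {P = Codes E n} ⌋
    ; cong      = λ (E⊆E′ , E′⊆E) n → T-⇔⇒≡ (mk⇔
        (fromWitness ∘ Codes-resp E⊆E′ ∘ toWitness) (fromWitness ∘ Codes-resp E′⊆E ∘ toWitness))
    ; injective = λ eqs → reflects eqs , reflects (sym ∘ eqs)
    }

theorem2 : (∀ a → ExcludedMiddle a) →
    ∀ (c ℓ k : Level) → Bijection (ℕ →-setoid Bool) (EquationalTheories c ℓ k)
theorem2 em c ℓ k = CantorBernstein.bijection em (theory em c ℓ k) (characteristic em c ℓ k)
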